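{- For every $n>1$, the game Cycles with Sources played on the graph consisting of a single simple cycle with $n$ edges, all edges being initially unmarked, has Nimber $0$.
   Context: The graph is the cycle with $n$ vertices and $n$ edges (for $n=2$, two vertices joined by two parallel edges). Cycles with Sources is the following two-player impartial game on a graph. Initially all edges are unmarked. The players alternate; a move consists of choosing an unmarked edge and marking it with an arrow in one of its two directions, subject to the rule that no move may create a sink. A sink is a vertex all of whose incident edges are marked and directed toward it. Creating sources (vertices all of whose incident edges are marked and directed away from them) is allowed. A player wins by completing a cycle cell (a cell of the graph all of whose boundary edges are marked in one consistent cyclic direction) or by making the last legal move. On a graph consisting of a single cycle, completing a cycle cell requires all edges to be marked, so the game is simply: the player who makes the last legal move wins. The Nimber (Sprague–Grundy value) of a position is the mex (minimum excluded non-negative integer) of the Nimbers of all positions reachable in one move. -}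

module Defs where

open import Data.Bool using (if_then_else_)
open import Data.Fin using (Fin; zero; suc; toℕ)
import Data.Fin.Properties as Fin
open import Data.List
  using (List; []; _∷_; [_]; map; filter; length; allFin; cartesianProduct)
import Data.List as List
open import Data.List.Membership.Propositional using (_∈_; _∉_; mapWith∈)
open import Data.List.Membership.Propositional.Properties
  using (∈-map⁻; ∈-filter⁻; mapWith∈-cong; mapWith∈≗map)
open import Data.List.Relation.Unary.All using (All)
import Data.List.Relation.Unary.All as All
open import Data.List.Relation.Unary.Any using (index)
import Data.List.Relation.Unary.Any as Any
open import Data.List.Relation.Unary.Any.Properties using (lookup-index)
open import Data.Maybe using (Maybe; just; nothing)
import Data.Maybe.Properties as Maybe
import Data.Maybe.Relation.Unary.Any as MaybeAny
open import Data.Nat using (ℕ; zero; suc; _+_; _<_; s≤s)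
open import Data.Nat.DivMod using (_mod_)
open import Data.Nat.Induction using (<-wellFounded)
import Data.Nat.Properties as ℕ
open import Data.List.Membership.DecPropositional ℕ._≟_ using (_∈?_)
open import Data.Product using (∃-syntax; _×_; _,_; proj₁; proj₂)
open import Data.Sum using (_⊎_; inj₁; inj₂)
open import Data.Vec using (Vec; []; _∷_; lookup; replicate; _[_]≔_)
open import Function using (_∘_; id)
open import Induction.WellFounded
  using (WellFounded; WfRec; module All; module FixPoint; module Subrelation)
open import Level using (0ℓ)
import Relation.Binary.Construct.On as On
open import Relation.Binary.PropositionalEquality
  using (_≡_; refl; sym; trans; cong)
open import Relation.Nullary
  using (¬_; Dec; yes; no; does; ¬?; _×-dec_; _⊎-dec_; _→-dec_)

------------------------------------------------------------------------
-- Minimum excluded value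

-- The search stops after length xs steps; by pigeonhole this is enough
-- (mex-∉).
mexFrom : ℕ → ℕ → List ℕ → ℕ
mexFrom zero       k xs = k
mexFrom (suc fuel) k xs =
  if does (k ∈? xs) then mexFrom fuel (suc k) xs else k

mex : List ℕ → ℕ
mex xs = mexFrom (length xs) 0 xs

private
  allBelow : ℕ → List ℕ → Set
  allBelow k xs = ∀ {j} → j < k → j ∈ xs

  extend : ∀ {k xs} → allBelow k xs → k ∈ xs → allBelow (suc k) xs
  extend below k∈ j<1+k with ℕ.m<1+n⇒m<n∨m≡n j<1+k
  ... | inj₁ j<k  = below j<k
  ... | inj₂ refl = k∈

  notAllBelow : ∀ xs → ¬ allBelow (suc (length xs)) xs
  notAllBelow xs below with Fin.pigeonhole (ℕ.n<1+n (length xs))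
                              (λ i → index (below (Fin.toℕ<n i)))
  ... | i , j , i<j , eq = ℕ.<⇒≢ i<j
    (trans (lookup-index (below (Fin.toℕ<n i)))
      (trans (cong (List.lookup xs) eq)
             (sym (lookup-index (below (Fin.toℕ<n j))))))

  mexFrom-correct : ∀ fuel k xs → fuel + k ≡ length xs → allBelow k xs →
    let m = mexFrom fuel k xs in m ∉ xs × allBelow m xs
  mexFrom-correct zero k xs refl below =
    (λ k∈ → notAllBelow xs (extend below k∈)) , below
  mexFrom-correct (suc fuel) k xs eq below with k ∈? xs
  ... | yes k∈ = mexFrom-correct fuel (suc k) xs
                   (trans (ℕ.+-suc fuel k) eq) (extend below k∈)
  ... | no  k∉ = k∉ , below

mex-∉ : ∀ xs → mex xs ∉ xs
mex-∉ xs = proj₁ (mexFrom-correct _ 0 xs (ℕ.+-identityʳ _) λ ())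

mex-least : ∀ xs {j} → j < mex xs → j ∈ xs
mex-least xs = proj₂ (mexFrom-correct _ 0 xs (ℕ.+-identityʳ _) λ ())

------------------------------------------------------------------------
-- Nimbers of terminating impartial games

module Nimber {P : Set} (options : P → List P)
              (wf : WellFounded (λ q p → q ∈ options p)) where

  private
    step : ∀ p → WfRec (λ q p → q ∈ options p) (λ _ → ℕ) p → ℕ
    step p rec = mex (mapWith∈ (options p) rec)

  nimber : P → ℕ
  nimber = All.wfRec wf 0ℓ (λ _ → ℕ) step

  nimber-unfold : ∀ p → nimber p ≡ mex (map nimber (options p))
  nimber-unfold p = trans
    (FixPoint.unfold-wfRec wf (λ _ → ℕ) step
      (λ q eq → cong mex (mapWith∈-cong (options q) _ _ eq)))
    (cong mex (mapWith∈≗map nimber (options p)))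

------------------------------------------------------------------------
-- Boards

data Direction : Set where
  forward backward : Direction

opposite : Direction → Direction
opposite forward  = backward
opposite backward = forward

infix 4 _≟ᵈ_

_≟ᵈ_ : (c d : Direction) → Dec (c ≡ d)
forward  ≟ᵈ forward  = yes refl
forward  ≟ᵈ backward = no λ ()
backward ≟ᵈ forward  = no λ ()
backward ≟ᵈ backward = yes refl

-- A finite multigraph with a list of cells.  The orientation given by tail
-- and head is only a reference for reading Direction.  A cell is given by
-- going once round its boundary, recording each edge with the direction in
-- which it is traversed.
record Board : Set where
  field
    vertices edges : ℕ
    tail head      : Fin edges → Fin vertices
    cells          : List (List (Fin edges × Direction))

-- Edge i joins vertex i to vertex i + 1 (mod n).  For n = 2 this gives two
-- parallel edges.
cycle : ℕ → Board
cycle n = record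
  { vertices = n
  ; edges    = n
  ; tail     = id
  ; head     = λ i → _mod_ (suc (toℕ i)) n {{Fin.nonZeroIndex i}}
  ; cells    = [ map (_, forward) (allFin n) ]
  }

------------------------------------------------------------------------
-- Cycles with Sources

module CyclesWithSources (B : Board) where
  open Board B

  -- nothing: unmarked.
  Position : Set
  Position = Vec (Maybe Direction) edges

  initial : Position
  initial = replicate edges nothing

  mark : Position → Fin edges → Direction → Position
  mark p e d = p [ e ]≔ just d

  Incident : Fin edges → Fin vertices → Set
  Incident e v = tail e ≡ v ⊎ head e ≡ v

  target : Fin edges → Direction → Fin vertices
  target e forward  = head e
  target e backward = tail e

  DirectedToward : Position → Fin edges → Fin vertices → Set
  DirectedToward p e v = MaybeAny.Any (λ d → target e d ≡ v) (lookup p e)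

  Sink : Position → Fin vertices → Set
  Sink p v = ∀ e → Incident e v → DirectedToward p e v

  CreatesSink : Position → Position → Set
  CreatesSink p q = ∃[ v ] (¬ Sink p v × Sink q v)

  MarkedAlong : (Direction → Direction) → Position →
                List (Fin edges × Direction) → Set
  MarkedAlong σ p = All (λ (e , d) → lookup p e ≡ just (σ d))

  CycleCell : Position → List (Fin edges × Direction) → Set
  CycleCell p c = MarkedAlong id p c ⊎ MarkedAlong opposite p c

  -- Completing a cycle cell wins at once, so no move follows it; the game
  -- thereby becomes one in which the last player to move wins.
  Finished : Position → Set
  Finished p = Any.Any (CycleCell p) cells

  Legal : Position → Fin edges × Direction → Set
  Legal p (e , d) =
    ¬ Finished p × lookup p e ≡ nothing × ¬ CreatesSink p (mark p e d)

  sink? : ∀ p v → Dec (Sink p v)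
  sink? p v = Fin.all? λ e →
    ((tail e Fin.≟ v) ⊎-dec (head e Fin.≟ v))
      →-dec MaybeAny.dec (λ d → target e d Fin.≟ v) (lookup p e)

  createsSink? : ∀ p q → Dec (CreatesSink p q)
  createsSink? p q = Fin.any? λ v → ¬? (sink? p v) ×-dec sink? q v

  finished? : ∀ p → Dec (Finished p)
  finished? p = Any.any? (λ c → along? id c ⊎-dec along? opposite c) cells
    where
    along? : ∀ σ c → Dec (MarkedAlong σ p c)
    along? σ = All.all? λ (e , d) →
      Maybe.≡-dec _≟ᵈ_ (lookup p e) (just (σ d))

  legal? : ∀ p m → Dec (Legal p m)
  legal? p (e , d) =
    ¬? (finished? p)
      ×-dec Maybe.≡-dec _≟ᵈ_ (lookup p e) nothing
      ×-dec ¬? (createsSink? p (mark p e d))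

  legalMoves : Position → List (Fin edges × Direction)
  legalMoves p = filter (legal? p)
    (cartesianProduct (allFin edges) (forward ∷ backward ∷ []))

  options : Position → List Position
  options p = map (λ (e , d) → mark p e d) (legalMoves p)

  private
    unmarked : ∀ {n} → Vec (Maybe Direction) n → ℕ
    unmarked []            = 0
    unmarked (nothing ∷ p) = suc (unmarked p)
    unmarked (just _ ∷ p)  = unmarked p

    unmarked-mark : ∀ {n} (p : Vec (Maybe Direction) n) e d →
      lookup p e ≡ nothing → unmarked (p [ e ]≔ just d) < unmarked p
    unmarked-mark (nothing ∷ p) zero    d eq = ℕ.n<1+n _
    unmarked-mark (nothing ∷ p) (suc e) d eq = s≤s (unmarked-mark p e d eq)
    unmarked-mark (just _ ∷ p)  (suc e) d eq = unmarked-mark p e d eq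

    decreasing : ∀ {q p} → q ∈ options p → unmarked q < unmarked p
    decreasing {p = p} q∈ with ∈-map⁻ _ q∈
    ... | (e , d) , m∈ , refl
      with ∈-filter⁻ (legal? p)
             {xs = cartesianProduct (allFin edges) (forward ∷ backward ∷ [])} m∈
    ... | _ , _ , free , _ = unmarked-mark p e d free

  options-wf : WellFounded (λ q p → q ∈ options p)
  options-wf = Subrelation.wellFounded decreasing
    (On.wellFounded unmarked <-wellFounded)

  open Nimber options options-wf public

{-# OPTIONS --safe #-}

-- Call two moves in conflict when they mark the same edge in both directions
-- or together make a sink.  The conflict graph on the 2n moves is itself a
-- cycle, on which i-backward, i-forward, (i+1)-backward, ... are consecutive,
-- and a move is legal exactly when neither it nor one of its two neighbours
-- has been played.  For n > 1 antipodal points of this cycle are neither equal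
-- nor adjacent, so the second player can always answer a move by its antipode.
module Submission where

open import Data.Fin using (Fin; toℕ)
import Data.Fin.Properties as Fin
open import Data.List using (List; []; _∷_; map; allFin; cartesianProduct)
open import Data.List.Membership.Propositional using (_∈_; _∉_)
open import Data.List.Membership.Propositional.Properties
  using (∈-map⁺; ∈-map⁻; ∈-filter⁺; ∈-filter⁻; ∈-cartesianProduct⁺; ∈-allFin)
import Data.List.Relation.Unary.All as All
open import Data.List.Relation.Unary.Any using (here; there)
open import Data.Maybe using (just; nothing)
import Data.Maybe.Relation.Unary.Any as MaybeAny
open import Data.Nat
  using (ℕ; zero; suc; _+_; _*_; _/_; _%_; pred; _<_; _>_; NonZero; >-nonZero; z<s)
open import Data.Nat.Divisibility using (divides; >⇒∤)
open import Data.Nat.DivMod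
  using (_mod_; m≡m%n+[m/n]*n; m<n⇒m%n≡m; m%n<n; [m+n]%n≡m%n; [m+kn]%n≡m%n; m%n*o≡m*o%[n*o])
open import Data.Nat.GeneralisedArithmetic using (fold; fold-+)
import Data.Nat.Properties as ℕ
open import Data.Product using (∃-syntax; _×_; _,_; proj₁; proj₂)
open import Data.Sum using (_⊎_; inj₁; inj₂)
open import Data.Vec using (lookup)
open import Data.Vec.Properties using (lookup∘update; lookup∘update′; lookup-replicate)
open import Induction.WellFounded using (WellFounded; Acc; acc)
open import Relation.Binary.PropositionalEquality
  using (_≡_; _≢_; refl; sym; trans; cong; subst; module ≡-Reasoning)
open import Relation.Nullary using (¬_; yes; no; contradiction)
open import Defs

-- Nimber zero from a reply strategy

0∉⇒mex≡0 : ∀ xs → 0 ∉ xs → mex xs ≡ 0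
0∉⇒mex≡0 xs 0∉ = go (mex xs) (mex-least xs)
  where
  go : ∀ m → (∀ {j} → j < m → j ∈ xs) → m ≡ 0
  go zero    below = refl
  go (suc m) below = contradiction (below z<s) 0∉

mex≡0⇒0∉ : ∀ xs → mex xs ≡ 0 → 0 ∉ xs
mex≡0⇒0∉ xs eq = subst (_∉ xs) eq (mex-∉ xs)

module _ {P : Set} (options : P → List P)
         (wf : WellFounded (λ q p → q ∈ options p)) where
  open Nimber options wf using (nimber; nimber-unfold)

  -- By induction the good reply `r` has nimber 0, so the option `q` it answers does not. Hence 0 is
  -- missing among the nimbers of the options of `p`.
  answerable⇒nimber≡0 : (Good : P → Set) →
    (∀ {p q} → Good p → q ∈ options p → ∃[ r ] (r ∈ options q × Good r)) →
    ∀ {p} → Good p → nimber p ≡ 0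
  answerable⇒nimber≡0 Good answer = go (wf _)
    where
    go : ∀ {p} → Acc (λ q p → q ∈ options p) p → Good p → nimber p ≡ 0
    go {p} (acc rs) good = trans (nimber-unfold p) (0∉⇒mex≡0 _ 0∉)
      where
      0∉ : 0 ∉ map nimber (options p)
      0∉ 0∈ with q , q∈ , 0≡q ← ∈-map⁻ nimber 0∈
            -- The induction descends two moves at a time, so accessibility is unpacked at `q` as
            -- well.
            with r , r∈ , good′ ← answer good q∈ with acc rs′ ← rs q∈ =
        mex≡0⇒0∉ _ (trans (sym (nimber-unfold q)) (sym 0≡q))
          (subst (_∈ _) (go (rs′ r∈) good′) (∈-map⁺ nimber r∈))

module OnCycle (n : ℕ) (n>1 : n > 1) where

  open CyclesWithSources (cycle n)

  private instance
    n≢0 : NonZero n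
    n≢0 = >-nonZero (ℕ.<⇒≤ n>1)

    2n≢0 : NonZero (n * 2)
    2n≢0 = ℕ.m*n≢0 n 2

  -- The cyclic order of the moves

  Edge Move : Set
  Edge = Fin n
  Move = Edge × Direction

  next : Edge → Edge
  next e = suc (toℕ e) mod n

  step : Move → Move
  step (e , backward) = e , forward
  step (e , forward)  = next e , backward

  -- Numbers the moves in the order of the conflict cycle, so that `step` becomes successor modulo
  -- 2n.
  code : Move → ℕ
  code (e , backward) = toℕ e * 2
  code (e , forward)  = suc (toℕ e * 2)

  code<2n : ∀ m → code m < n * 2
  code<2n (e , d) = ℕ.≤-trans (bound d) (ℕ.*-monoˡ-≤ 2 (Fin.toℕ<n e))
    where
    bound : ∀ d → code (e , d) < suc (toℕ e) * 2
    bound forward  = ℕ.≤-refl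
    bound backward = ℕ.n≤1+n _

  code-injective : ∀ x y → code x ≡ code y → x ≡ y
  code-injective (e , backward) (f , backward) eq =
    cong (_, backward) (Fin.toℕ-injective (ℕ.*-cancelʳ-≡ _ _ 2 eq))
  code-injective (e , forward) (f , forward) eq =
    cong (_, forward) (Fin.toℕ-injective (ℕ.*-cancelʳ-≡ _ _ 2 (ℕ.suc-injective eq)))
  code-injective (e , backward) (f , forward) eq
    rewrite ℕ.*-comm (toℕ e) 2 | ℕ.*-comm (toℕ f) 2 =
    contradiction eq (ℕ.even≢odd (toℕ e) (toℕ f))
  code-injective (e , forward) (f , backward) eq
    rewrite ℕ.*-comm (toℕ e) 2 | ℕ.*-comm (toℕ f) 2 =
    contradiction (sym eq) (ℕ.even≢odd (toℕ f) (toℕ e))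

  code-step : ∀ m → code (step m) ≡ suc (code m) % (n * 2)
  code-step (e , backward) = sym (m<n⇒m%n≡m (code<2n (e , forward)))
  code-step (e , forward)  = trans
    -- Reduction of the edge index modulo n turns, after doubling, into reduction of the code modulo
    -- 2n.
    (cong (_* 2) (Fin.toℕ-fromℕ< (m%n<n (suc (toℕ e)) n)))
    (m%n*o≡m*o%[n*o] (suc (toℕ e)) n 2)

  code-fold : ∀ m k → code (fold m step k) ≡ (k + code m) % (n * 2)
  code-fold m zero    = sym (m<n⇒m%n≡m (code<2n m))
  code-fold m (suc k) = begin
    code (step (fold m step k))             ≡⟨ code-step (fold m step k) ⟩
    suc (code (fold m step k)) % (n * 2)    ≡⟨ cong (λ c → suc c % (n * 2)) (code-fold m k) ⟩
    suc ((k + code m) % (n * 2)) % (n * 2)  ≡⟨ suc-% (k + code m) ⟩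
    suc (k + code m) % (n * 2)              ∎
    where
    open ≡-Reasoning
    suc-% : ∀ a → suc (a % (n * 2)) % (n * 2) ≡ suc a % (n * 2)
    suc-% a = begin
      suc (a % (n * 2)) % (n * 2)
        ≡⟨ [m+kn]%n≡m%n (suc (a % (n * 2))) (a / (n * 2)) (n * 2) ⟨
      suc (a % (n * 2) + a / (n * 2) * (n * 2)) % (n * 2)
        ≡⟨ cong (λ b → suc b % (n * 2)) (m≡m%n+[m/n]*n a (n * 2)) ⟨
      suc a % (n * 2) ∎

  fold-2n : ∀ m → fold m step (n * 2) ≡ m
  fold-2n m = code-injective _ _ (begin
    code (fold m step (n * 2))  ≡⟨ code-fold m (n * 2) ⟩
    (n * 2 + code m) % (n * 2)  ≡⟨ cong (_% (n * 2)) (ℕ.+-comm (n * 2) (code m)) ⟩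
    (code m + n * 2) % (n * 2)  ≡⟨ [m+n]%n≡m%n (code m) (n * 2) ⟩
    code m % (n * 2)            ≡⟨ m<n⇒m%n≡m (code<2n m) ⟩
    code m                      ∎)
    where open ≡-Reasoning

  -- A return to `m` leaves the code unchanged modulo 2n, so 2n would divide `k`, which is
  -- impossible for 0 < k < 2n.
  fold-no-fixpoint : ∀ m {k} .{{_ : NonZero k}} → k < n * 2 → fold m step k ≢ m
  fold-no-fixpoint m {k} k<2n eq = >⇒∤ k<2n (divides q k≡q*2n)
    where
    open ≡-Reasoning
    q = (k + code m) / (n * 2)
    k≡q*2n : k ≡ q * (n * 2)
    k≡q*2n = ℕ.+-cancelʳ-≡ (code m) _ _ (begin
      k + code m
        ≡⟨ m≡m%n+[m/n]*n (k + code m) (n * 2) ⟩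
      (k + code m) % (n * 2) + q * (n * 2)
        ≡⟨ cong (_+ q * (n * 2)) (trans (sym (code-fold m k)) (cong code eq)) ⟩
      code m + q * (n * 2)
        ≡⟨ ℕ.+-comm (code m) _ ⟩
      q * (n * 2) + code m ∎)

  -- Since 2n steps make a full turn, iterating `step` 2n - 1 times inverts it.
  step-injective : ∀ {x y} → step x ≡ step y → x ≡ y
  step-injective {x} {y} eq = begin
    x                                    ≡⟨ undo x ⟨
    fold (step x) step (pred (n * 2))    ≡⟨ cong (λ z → fold z step (pred (n * 2))) eq ⟩
    fold (step y) step (pred (n * 2))    ≡⟨ undo y ⟩
    y                                    ∎
    where
    open ≡-Reasoning
    undo : ∀ z → fold (step z) step (pred (n * 2)) ≡ z
    undo z = begin
      fold (step z) step (pred (n * 2))  ≡⟨ fold-+ z step (pred (n * 2)) ⟨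
      fold z step (pred (n * 2) + 1)     ≡⟨ cong (fold z step) (trans (ℕ.+-comm _ 1) (ℕ.suc-pred (n * 2))) ⟩
      fold z step (n * 2)                ≡⟨ fold-2n z ⟩
      z                                  ∎

  -- Antipodal moves and neighbouring edges

  antipode : Move → Move
  antipode m = fold m step n

  private
    n+n≡2n : n + n ≡ n * 2
    n+n≡2n = sym (trans (ℕ.*-comm n 2) (cong (n +_) (ℕ.+-identityʳ n)))

  antipode-involutive : ∀ m → antipode (antipode m) ≡ m
  antipode-involutive m = trans (sym (fold-+ m step n))
    (trans (cong (fold m step) n+n≡2n) (fold-2n m))

  step-antipode : ∀ m → step (antipode m) ≡ antipode (step m)
  step-antipode m = trans (cong (fold m step) (ℕ.+-comm 1 n)) (fold-+ m step n)

  -- The bound that keeps a move and its antipode from being equal or adjacent; this is where n > 1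
  -- enters.
  1+n<2n : suc n < n * 2
  1+n<2n = subst (suc n <_) n+n≡2n (ℕ.+-monoˡ-< n n>1)

  antipode≢ : ∀ m → antipode m ≢ m
  antipode≢ m = fold-no-fixpoint m (ℕ.<⇒≤ 1+n<2n)

  step-antipode≢ : ∀ m → step (antipode m) ≢ m
  step-antipode≢ m = fold-no-fixpoint m 1+n<2n

  -- Two steps lead from `(e , backward)` to `(next e , backward)`, and 2 < 2n. Thus no edge is a
  -- loop.
  next≢ : ∀ e → next e ≢ e
  next≢ e eq = fold-no-fixpoint (e , backward) {2}
    (ℕ.*-monoˡ-< 2 n>1) (cong (_, backward) eq)

  next-injective : ∀ {e f} → next e ≡ next f → e ≡ f
  next-injective {e} {f} eq =
    cong proj₁ (step-injective {e , forward} {f , forward} (cong (_, backward) eq))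

  next-surjective : ∀ v → ∃[ e ] next e ≡ v
  next-surjective v with fold (v , backward) step (pred (n * 2)) in eq
  ... | e , d = e , pre d (trans (cong step (sym eq)) turn)
    where
    turn : fold (v , backward) step (suc (pred (n * 2))) ≡ (v , backward)
    turn = trans (cong (fold _ step) (ℕ.suc-pred (n * 2))) (fold-2n _)
    pre : ∀ d → step (e , d) ≡ (v , backward) → next e ≡ v
    -- The predecessor of a backward move is forward, so the other case is absurd.
    pre forward refl = refl

  -- Legality as freedom from conflict

  Played : Position → Move → Set
  Played p (e , d) = lookup p e ≡ just d

  play : Position → Move → Position
  play p (e , d) = mark p e d

  -- The last component speaks of the preceding neighbour through preimages of `step`, so that no
  -- inverse has to be named.
  Free : Position → Move → Set
  Free p m = ¬ Played p m × ¬ Played p (step m) × (∀ x → step x ≡ m → ¬ Played p x)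

  played-unique : ∀ p {e c d} → Played p (e , c) → Played p (e , d) → c ≡ d
  played-unique p a b with refl ← trans (sym a) b = refl

  play-here : ∀ p m → Played (play p m) m
  play-here p (e , d) = lookup∘update e p (just d)

  play-there : ∀ p m x → lookup p (proj₁ m) ≡ nothing → Played p x → Played (play p m) x
  play-there p (e , d) (f , c) free px = trans (lookup∘update′ f≢e p (just d)) px
    where
    f≢e : f ≢ e
    f≢e refl with () ← trans (sym free) px

  play⁻ : ∀ p m x → Played (play p m) x → x ≡ m ⊎ Played p x
  play⁻ p (e , d) (f , c) px with f Fin.≟ e
  ... | yes refl = inj₁ (cong (e ,_) (played-unique (play p (e , d)) px (play-here p (e , d))))
  ... | no f≢e   = inj₂ (trans (sym (lookup∘update′ f≢e p (just d))) px)

  -- By injectivity of `next`, only `e` and `next e` meet at `next e`.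
  sink⁺ : ∀ p e → Played p (e , forward) → Played p (next e , backward) → Sink p (next e)
  sink⁺ p e pe pe′ f (inj₁ refl) rewrite pe′ = MaybeAny.just refl
  sink⁺ p e pe pe′ f (inj₂ eq) with refl ← next-injective {f} {e} eq rewrite pe =
    MaybeAny.just refl

  -- Each of the two edges has distinct ends, so only one of its directions points to `next e`.
  sink⁻ : ∀ p e → Sink p (next e) → Played p (e , forward) × Played p (next e , backward)
  sink⁻ p e sink =
    atTail (lookup p e) (sink e (inj₂ refl)) ,
    atHead (lookup p (next e)) (sink (next e) (inj₁ refl))
    where
    atTail : ∀ o → MaybeAny.Any (λ d → target e d ≡ next e) o → o ≡ just forward
    atTail (just forward)  _                  = refl
    atTail (just backward) (MaybeAny.just eq) = contradiction (sym eq) (next≢ e)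
    atHead : ∀ o → MaybeAny.Any (λ d → target (next e) d ≡ next e) o → o ≡ just backward
    atHead (just backward) _                  = refl
    atHead (just forward)  (MaybeAny.just eq) = contradiction eq (next≢ (next e))

  legal⇒free : ∀ p m → Legal p m → Free p m
  legal⇒free p (e , d) (_ , free , sinkless) =
    unplayed , stepUnplayed d sinkless , preUnplayed d sinkless
    where
    unplayed : ∀ {c} → ¬ Played p (e , c)
    unplayed pe with () ← trans (sym free) pe

    stepUnplayed : ∀ d → ¬ CreatesSink p (mark p e d) → ¬ Played p (step (e , d))
    stepUnplayed backward _  = unplayed
    stepUnplayed forward  sl pe′ = sl
      ( next e
      -- The sink is new: before the move, the edge being marked was still unmarked.
      , (λ s → unplayed (proj₁ (sink⁻ p e s)))
      , sink⁺ (play p (e , forward)) e (play-here p (e , forward))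
          (play-there p (e , forward) (next e , backward) free pe′))

    preUnplayed : ∀ d → ¬ CreatesSink p (mark p e d) → ∀ x → step x ≡ (e , d) → ¬ Played p x
    preUnplayed forward  _  (f , backward) refl = unplayed
    preUnplayed backward sl (f , forward)  refl pf = sl
      ( next f
      , (λ s → unplayed (proj₂ (sink⁻ p f s)))
      , sink⁺ (play p (next f , backward)) f
          (play-there p (next f , backward) (f , forward) free pf)
          (play-here p (next f , backward)))

  -- The two directions of one edge are neighbours on the conflict cycle, so freedom rules out both.
  free⇒unmarked : ∀ p m → Free p m → lookup p (proj₁ m) ≡ nothing
  free⇒unmarked p (e , d) free = go (lookup p e) refl
    where
    ¬played : ∀ c d → Free p (e , d) → ¬ Played p (e , c)
    ¬played forward  forward  (¬m , _ , _)    = ¬m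
    ¬played backward backward (¬m , _ , _)    = ¬m
    ¬played forward  backward (_ , ¬step , _) = ¬step
    ¬played backward forward  (_ , _ , ¬pre)  = ¬pre (e , backward) refl

    go : ∀ o → lookup p e ≡ o → o ≡ nothing
    go nothing  _  = refl
    go (just c) pe = contradiction pe (¬played c d free)

  -- The only cell runs through every edge.
  unmarked⇒unfinished : ∀ p e → lookup p e ≡ nothing → ¬ Finished p
  unmarked⇒unfinished p e free (here (inj₁ along))
    with () ← trans (sym free) (All.lookup along (∈-map⁺ _ (∈-allFin e)))
  unmarked⇒unfinished p e free (here (inj₂ along))
    with () ← trans (sym free) (All.lookup along (∈-map⁺ _ (∈-allFin e)))

  free⇒legal : ∀ p m → Free p m → Legal p m
  free⇒legal p m@(e , d) free@(_ , ¬step , ¬pre) =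
    unmarked⇒unfinished p e unmarked , unmarked , sinkless
    where
    unmarked = free⇒unmarked p m free

    sinkless : ¬ CreatesSink p (play p m)
    sinkless (v , ¬sink , sink) with f , refl ← next-surjective v
      with pf , pf′ ← sink⁻ (play p m) f sink
      -- Of the two moves forming the sink, `m` is at most one. If it is one, the other is a played
      -- neighbour of `m`; if neither, the sink was there before.
      with play⁻ p m (f , forward) pf | play⁻ p m (next f , backward) pf′
    ... | inj₁ refl | inj₂ qf′  = ¬step qf′
    ... | inj₂ qf   | inj₁ refl = ¬pre (f , forward) refl qf
    ... | inj₂ qf   | inj₂ qf′  = ¬sink (sink⁺ p f qf qf′)

  ∈-options⁻ : ∀ {p q} → q ∈ options p → ∃[ m ] (Free p m × q ≡ play p m)
  ∈-options⁻ {p} q∈ with m , m∈ , eq ← ∈-map⁻ _ q∈ =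
    m , legal⇒free p m (proj₂ (∈-filter⁻ (legal? p) {xs = cartesianProduct (allFin n) _} m∈)) , eq

  ∈-options⁺ : ∀ p m → Free p m → play p m ∈ options p
  ∈-options⁺ p m@(e , d) free =
    ∈-map⁺ _ (∈-filter⁺ (legal? p)
      (∈-cartesianProduct⁺ (∈-allFin e) (direction∈ d)) (free⇒legal p m free))
    where
    direction∈ : ∀ d → d ∈ forward ∷ backward ∷ []
    direction∈ forward  = here refl
    direction∈ backward = there (here refl)

  -- The antipodal reply

  Symmetric : Position → Set
  Symmetric p = ∀ x → Played p x → Played p (antipode x)

  initial-symmetric : Symmetric initial
  initial-symmetric (e , d) pe with () ← trans (sym (lookup-replicate e nothing)) pe

  -- A conflict of the reply with a move played in `p` reflects, by symmetry, to a conflict of `m`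
  -- itself. The only other move to check is `m`, which is neither the reply nor its neighbour.
  antipode-free : ∀ p m → Symmetric p → Free p m → Free (play p m) (antipode m)
  antipode-free p m symm (¬m , ¬step , ¬pre) = ¬m′ , ¬step′ , ¬pre′
    where
    ¬m′ : ¬ Played (play p m) (antipode m)
    ¬m′ pm with play⁻ p m _ pm
    ... | inj₁ eq = antipode≢ m eq
    ... | inj₂ qm = ¬m (subst (Played p) (antipode-involutive m) (symm _ qm))

    ¬step′ : ¬ Played (play p m) (step (antipode m))
    ¬step′ pm with play⁻ p m _ pm
    ... | inj₁ eq = step-antipode≢ m eq
    ... | inj₂ qm = ¬step (subst (Played p)
      (trans (cong antipode (step-antipode m)) (antipode-involutive (step m))) (symm _ qm))

    ¬pre′ : ∀ x → step x ≡ antipode m → ¬ Played (play p m) x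
    ¬pre′ x eq px = case (play⁻ p m x px)
      where
      stepAntipode≡ : step (antipode x) ≡ m
      stepAntipode≡ =
        trans (step-antipode x) (trans (cong antipode eq) (antipode-involutive m))

      case : ¬ (x ≡ m ⊎ Played p x)
      -- If `m` preceded its antipode, then by reflection the antipode would precede `m`.
      case (inj₁ refl) = step-antipode≢ m stepAntipode≡
      case (inj₂ qx)   = ¬pre (antipode x) stepAntipode≡ (symm x qx)

  antipode-unmarked : ∀ p m → Symmetric p → Free p m →
    lookup (play p m) (proj₁ (antipode m)) ≡ nothing
  antipode-unmarked p m symm free =
    free⇒unmarked (play p m) (antipode m) (antipode-free p m symm free)

  answer-symmetric : ∀ p m → Symmetric p → Free p m →
    Symmetric (play (play p m) (antipode m))
  answer-symmetric p m symm free x px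
    with play⁻ (play p m) (antipode m) x px
  -- The antipode of the reply is `m`, whose mark survives the reply.
  ... | inj₁ refl =
    subst (Played (play (play p m) (antipode m))) (sym (antipode-involutive m))
      (play-there (play p m) (antipode m) m (antipode-unmarked p m symm free) (play-here p m))
  ... | inj₂ qx with play⁻ p m x qx
  ...   | inj₁ refl = play-here (play p m) (antipode m)
  ...   | inj₂ rx   = play-there (play p m) (antipode m) (antipode x)
    (antipode-unmarked p m symm free)
    (play-there p m (antipode x) (free⇒unmarked p m free) (symm x rx))

  answer : ∀ {p q} → Symmetric p → q ∈ options p → ∃[ r ] (r ∈ options q × Symmetric r)
  answer {p} symm q∈ with m , free , refl ← ∈-options⁻ q∈ =
    _ , ∈-options⁺ _ (antipode m) (antipode-free p m symm free) , answer-symmetric p m symm free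

  nimber-initial : nimber initial ≡ 0
  nimber-initial = answerable⇒nimber≡0 options options-wf Symmetric answer initial-symmetric

theorem5 : ∀ (n : ℕ) → n > 1 →
    let open CyclesWithSources (cycle n) in nimber initial ≡ 0
theorem5 n n>1 = OnCycle.nimber-initial n n>1
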